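{- If $q = cn$ for some constant $c > 0$, then $\mathcal{L}(n,q) = \Omega(\ln n)$. That is, for every constant $c>0$ there exist a constant $c'>0$ and an integer $n_0$ such that $\mathcal{L}(n,q) \geq c' \ln n$ for all positive integers $n \geq n_0$ and $q$ with $q = cn$.
   Context: The $(q:1)$ Waiter-Client game on $E(K_n)$ (for a positive integer $q$) is the following two-player perfect information game. In each round, Waiter offers Client exactly $q+1$ edges of the complete graph $K_n$ which have not been claimed before; Client chooses one of these edges, which he keeps, and the remaining $q$ edges are claimed by Waiter. If fewer than $q+1$ unclaimed edges remain, all of them are claimed by Waiter. The game ends when all edges of $K_n$ have been claimed. Client's graph is the graph with vertex set $V(K_n)$ whose edges are all the edges claimed by Client. $\mathcal{L}(n,q)$ denotes the order (number of vertices) of a largest connected component of Client's graph at the end of the $(q:1)$ Waiter-Client game on $E(K_n)$ when Client tries to minimize this quantity, Waiter tries to maximize it, and both follow optimal strategies. -}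

module Defs where

open import Data.Nat using (ℕ; zero; suc; _+_; _*_; _∸_; _/_; _⊓_)
open import Data.Integer using (+_)
open import Data.Rational as ℚ using (ℚ; 0ℚ)
open import Data.Fin using (Fin; _<?_; _≟_)
open import Data.List using (List; []; _∷_; [_]; _++_; map; filter; length; foldr; upTo; allFin; cartesianProduct)
open import Data.List.Extrema.Nat using (max)
open import Data.List.Membership.Propositional using (_∈_)
open import Data.List.Relation.Unary.Any using (here; there)
open import Data.Vec as Vec using (Vec; []; _∷_)
open import Data.Product using (_×_; _,_)
open import Data.Sum using (_⊎_; inj₁; inj₂)
open import Relation.Binary.Construct.Closure.Equivalence using (EqClosure)
open import Relation.Binary.Construct.Closure.ReflexiveTransitive as Star using (ε; _◅_; _◅◅_)
open import Relation.Binary.Construct.Closure.Symmetric as Sym using (fwd; bwd)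
open import Relation.Nullary using (Dec; ¬_)
open import Relation.Nullary.Decidable using (map′; _⊎-dec_; _×-dec_)
open import Relation.Binary.PropositionalEquality using (_≡_; refl)

-- An edge {u , v} of Kₙ is stored once, as the pair (u , v) with u < v.

Edge : ℕ → Set
Edge n = Fin n × Fin n

edgesK : (n : ℕ) → List (Edge n)
edgesK n = filter (λ (u , v) → u <? v) (cartesianProduct (allFin n) (allFin n))

-- A graph on the vertex set Fin n is given by its list of edges.

Graph : ℕ → Set
Graph n = List (Edge n)

-- Elements are walks: EqClosure is Star ∘ SymClosure, and SymClosure forgets
-- the orientation of the stored pairs.

Connected : ∀ {n} → Graph n → Fin n → Fin n → Set
Connected G = EqClosure (λ u v → (u , v) ∈ G)

private
  weaken : ∀ {n} {e : Edge n} {G u v} → Connected G u v → Connected (e ∷ G) u v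
  weaken = Star.map (Sym.map there)

  Split : ∀ {n} → Edge n → Graph n → Fin n → Fin n → Set
  Split (a , b) G u v =
    Connected G u v ⊎
    (Connected G u a × Connected G b v) ⊎
    (Connected G u b × Connected G a v)

  join : ∀ {n} (e : Edge n) {G u v} → Split e G u v → Connected (e ∷ G) u v
  join e (inj₁ p)              = weaken p
  join e (inj₂ (inj₁ (p , r))) = weaken p ◅◅ fwd (here refl) ◅ weaken r
  join e (inj₂ (inj₂ (p , r))) = weaken p ◅◅ bwd (here refl) ◅ weaken r

  split : ∀ {n} (e : Edge n) {G u v} → Connected (e ∷ G) u v → Split e G u v
  split e ε = inj₁ ε
  split e (fwd (here refl) ◅ p) with split e p
  ... | inj₁ r              = inj₂ (inj₁ (ε , r))
  ... | inj₂ (inj₁ (_ , r)) = inj₂ (inj₁ (ε , r))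
  ... | inj₂ (inj₂ (_ , r)) = inj₁ r
  split e (bwd (here refl) ◅ p) with split e p
  ... | inj₁ r              = inj₂ (inj₂ (ε , r))
  ... | inj₂ (inj₁ (_ , r)) = inj₁ r
  ... | inj₂ (inj₂ (_ , r)) = inj₂ (inj₂ (ε , r))
  split e (fwd (there i) ◅ p) with split e p
  ... | inj₁ r              = inj₁ (fwd i ◅ r)
  ... | inj₂ (inj₁ (s , r)) = inj₂ (inj₁ (fwd i ◅ s , r))
  ... | inj₂ (inj₂ (s , r)) = inj₂ (inj₂ (fwd i ◅ s , r))
  split e (bwd (there i) ◅ p) with split e p
  ... | inj₁ r              = inj₁ (bwd i ◅ r)
  ... | inj₂ (inj₁ (s , r)) = inj₂ (inj₁ (bwd i ◅ s , r))
  ... | inj₂ (inj₂ (s , r)) = inj₂ (inj₂ (bwd i ◅ s , r))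

  trivial : ∀ {n} {u v : Fin n} → Connected [] u v → u ≡ v
  trivial ε            = refl
  trivial (fwd () ◅ _)
  trivial (bwd () ◅ _)

connected? : ∀ {n} (G : Graph n) (u v : Fin n) → Dec (Connected G u v)
connected? []            u v = map′ (λ { refl → ε }) trivial (u ≟ v)
connected? (e@(a , b) ∷ G) u v = map′ (join e) (split e)
  (connected? G u v ⊎-dec
   ((connected? G u a ×-dec connected? G b v) ⊎-dec
    (connected? G u b ×-dec connected? G a v)))

componentOrder : ∀ {n} → Graph n → Fin n → ℕ
componentOrder {n} G u = length (filter (connected? G u) (allFin n))

largestComponent : ∀ {n} → Graph n → ℕ
largestComponent {n} G = max 0 (map (componentOrder G) (allFin n))

-- All ways of selecting k entries of a list, each with the unselected entries.

choose : ∀ {A : Set} (k : ℕ) → List A → List (Vec A k × List A)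
choose zero    xs       = [ [] , xs ]
choose (suc k) []       = []
choose (suc k) (x ∷ xs) =
  map (λ (ys , zs) → x ∷ ys , zs) (choose k xs) ++
  map (λ (ys , zs) → ys , x ∷ zs) (choose (suc k) xs)

-- The minimax value of the (q : 1) game with r full rounds still to be played,
-- where free holds the unclaimed edges and G is Client's current graph. Waiter
-- maximizes over his possible offers, Client minimizes over the q + 1 offered
-- edges. Edges left over after the last full round go to Waiter, so they do
-- not change Client's graph.

value : ∀ {n} (q r : ℕ) (free : List (Edge n)) (G : Graph n) → ℕ
value q zero    free G = largestComponent G
value q (suc r) free G =
  max 0 (map (λ (offer , rest) →
                Vec.foldr₁ _⊓_ (Vec.map (λ e → value q r rest (e ∷ G)) offer))
             (choose (suc q) free))

-- Every full round uses up exactly q + 1 edges, whence the number of rounds.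
-- In particular the maximum over offers in value is never over an empty list.

𝓛 : (n q : ℕ) → ℕ
𝓛 n q = value q (length (edgesK n) / suc q) (edgesK n) []

fromℕ : ℕ → ℚ
fromℕ k = + k ℚ./ 1

-- The lower Darboux sum of ∫₁ⁿ dx/x for the partition of [1 , n] into
-- intervals of length 1/m: its terms are (1/m) · 1/(1 + (i+1)/m) = 1/(m + i + 1)
-- for 0 ≤ i < (n - 1) m. For m = 0 it is the empty sum.

lnLowerSum : (n m : ℕ) → ℚ
lnLowerSum n m = foldr ℚ._+_ 0ℚ (map (λ i → + 1 ℚ./ suc (m + i)) (upTo ((n ∸ 1) * m)))

-- The inequality a · ln n ≤ x between real numbers, for rational a ≥ 0 and
-- n ≥ 1: as ln n = ∫₁ⁿ dx/x is the supremum of its lower sums, it says that x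
-- is an upper bound of their multiples by a.

_·ln_≤_ : ℚ → ℕ → ℚ → Set
a ·ln n ≤ x = ∀ m → a ℚ.* lnLowerSum n m ℚ.≤ x

module Submission where

-- Waiter builds trees layer by layer. He maintains a set A of tips, each joined
-- to s vertices, and a reserve R such that all edges within A ∪ R are still
-- unclaimed. He cuts R into blocks so large that A and a block span at least
-- q + 1 edges, and offers q + 1 of the edges between A and each block in turn:
-- whichever edge a r Client takes, r becomes a tip joined to s + 1 vertices. The
-- edges inside the reserve stay untouched, so the unused vertices serve again.
-- When q ≤ C n and K = C + 2, one such stage turns K^(k+1) tips into K^k, whence
-- about log_K n stages can be played.

open import Defs
open import Data.Nat
open import Data.Nat.DivMod using (m<n⇒m/n≡0; m/n≡1+[m∸n]/n; m/n*n≤m; m≡m%n+[m/n]*n; m%n<n)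
open import Data.Nat.Properties
open import Data.Integer as ℤ using (+_; +≤+)
import Data.Integer.Properties as ℤ
open import Data.Rational as ℚ using (ℚ; 0ℚ; 1ℚ; mkℚ)
import Data.Rational.Properties as ℚ
open import Data.Rational.Unnormalised as ℚᵘ using (mkℚᵘ)
import Data.Rational.Unnormalised.Properties as ℚᵘ
open import Data.Fin as Fin using (Fin)
import Data.Fin.Properties as Fin
open import Data.List
  using (List; []; _∷_; [_]; _++_; map; filter; length; foldr; take; drop; applyUpTo; allFin; cartesianProduct)
open import Data.List.Extrema.Nat using (v≤max⁺)
open import Data.List.Membership.Propositional using (_∈_; _∉_; lose)
open import Data.List.Membership.Propositional.Properties
import Data.List.Membership.DecPropositional as DecMembership
open import Data.List.Properties as List
  using (length-++; length-map; length-take; length-drop; length-tabulate; take++drop≡id; ++-assoc; map-upTo;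
         filter-all)
open import Data.List.Relation.Binary.Disjoint.Propositional using (Disjoint)
open import Data.List.Relation.Binary.Permutation.Propositional
  using (_↭_; ↭-sym; ↭⇒↭ₛ; module PermutationReasoning)
import Data.List.Relation.Binary.Permutation.Propositional.Properties as Perm
open import Data.List.Relation.Binary.Permutation.Setoid.Properties using (Unique-resp-↭)
open import Data.List.Relation.Binary.Subset.Propositional using (_⊆_)
open import Data.List.Relation.Unary.All as All using ([]; _∷_)
import Data.List.Relation.Unary.All.Properties as All
open import Data.List.Relation.Unary.AllPairs using ([]; _∷_)
open import Data.List.Relation.Unary.Any using (here; there)
open import Data.List.Relation.Unary.Unique.Propositional using (Unique)
import Data.List.Relation.Unary.Unique.Propositional.Properties as Unique
open import Data.Product using (_×_; _,_; proj₁; proj₂; ∃₂; ∃-syntax)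
open import Data.Sum as Sum using (_⊎_; inj₁; inj₂)
open import Data.Unit using (⊤; tt)
open import Data.Vec as Vec using (Vec; []; _∷_)
open import Data.Vec.Relation.Unary.All as VAll using ([]; _∷_)
open import Function using (_∘_; id)
open import Relation.Binary.Construct.Closure.ReflexiveTransitive as Star using (ε; _◅_; _◅◅_)
open import Relation.Binary.Construct.Closure.Symmetric as Sym using (fwd; bwd)
open import Relation.Binary.Definitions using (tri<; tri≈; tri>)
open import Relation.Binary.PropositionalEquality hiding ([_])
open import Relation.Nullary using (¬_; yes; no; contradiction)
open import Relation.Nullary.Decidable using (_⊎-dec_; _×-dec_)
open import Relation.Unary using (Decidable)

private
  variable
    A B : Set

-- Counting in lists and selecting an offer.

Unique-++⁻ : ∀ (xs : List A) {ys} → Unique (xs ++ ys) → Unique xs × Unique ys × Disjoint xs ys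
Unique-++⁻ []       u = [] , u , λ { (() , _) }
Unique-++⁻ (x ∷ xs) (x∉ ∷ u) with Unique-++⁻ xs u
... | ux , uy , d = All.++⁻ˡ xs x∉ ∷ ux , uy , λ
  { (here refl , y) → All.lookup (All.++⁻ʳ xs x∉) y refl
  ; (there i , y) → d (i , y) }

-- Matching by deletion: the partner `y` of the head is removed from `ys`, and injectivity of `T`
-- shows that it is no partner of a later element. `T` is a relation, not a function, because an
-- edge may be stored in either of two orientations.
unique-length-≤ : (T : A → B → Set) {xs : List A} (ys : List B) → Unique xs →
  (∀ {x} → x ∈ xs → ∃[ y ] y ∈ ys × T x y) →
  (∀ {x x′ y} → x ∈ xs → x′ ∈ xs → T x y → T x′ y → x ≡ x′) →
  length xs ≤ length ys
unique-length-≤ T {[]}     ys _        _   _   = z≤n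
unique-length-≤ T {x ∷ xs} ys (x∉ ∷ u) tot inj with tot (here refl)
... | y , y∈ys , Txy with ∈-∃++ y∈ys
... | as , bs , refl = begin
  suc (length xs)         ≤⟨ s≤s (unique-length-≤ T (as ++ bs) u tot′ λ i j → inj (there i) (there j)) ⟩
  suc (length (as ++ bs)) ≡⟨ Perm.↭-length (Perm.shift y as bs) ⟨
  length (as ++ y ∷ bs)   ∎
  where
  open ≤-Reasoning
  tot′ : ∀ {x′} → x′ ∈ xs → ∃[ y′ ] y′ ∈ as ++ bs × T x′ y′
  tot′ i with tot (there i)
  ... | y′ , y′∈ , t with Perm.∈-resp-↭ (Perm.shift y as bs) y′∈
  ... | here refl = contradiction (inj (here refl) (there i) Txy t) (All.lookup x∉ i)
  ... | there j   = y′ , j , t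

length-cartesianProduct : (xs : List A) (ys : List B) → length (cartesianProduct xs ys) ≡ length xs * length ys
length-cartesianProduct []       ys = refl
length-cartesianProduct (x ∷ xs) ys = trans (length-++ (map (x ,_) ys))
  (cong₂ _+_ (length-map (x ,_) ys) (length-cartesianProduct xs ys))

-- The first `k` entries satisfying `P` are selected, so entries failing `P` are never removed. For
-- Waiter this yields a legal offer of edges of a prescribed kind that leaves all other kinds
-- unclaimed.
choose-satisfying : {P : A → Set} (P? : Decidable P) (k : ℕ) (xs : List A) → k ≤ length (filter P? xs) →
  ∃₂ λ ys zs → (ys , zs) ∈ choose k xs × VAll.All P ys ×
    (∀ {x} → x ∈ xs → ¬ P x → x ∈ zs) × k + length zs ≡ length xs
choose-satisfying P? zero    xs       _ = [] , xs , here refl , [] , (λ i _ → i) , refl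
choose-satisfying P? (suc k) (x ∷ xs) k≤ with P? x
... | yes Px with choose-satisfying P? k xs (s≤s⁻¹ k≤)
...   | ys , zs , i , Pys , keep , len =
  x ∷ ys , zs , ∈-++⁺ˡ (∈-map⁺ _ i) , Px ∷ Pys ,
  (λ { (here refl) ¬P → contradiction Px ¬P ; (there j) → keep j }) ,
  cong suc len
choose-satisfying P? (suc k) (x ∷ xs) k≤ | no ¬Px with choose-satisfying P? (suc k) xs k≤
...   | ys , zs , i , Pys , keep , len =
  ys , x ∷ zs , ∈-++⁺ʳ (map _ (choose k xs)) (∈-map⁺ _ i) , Pys ,
  (λ { (here refl) _ → here refl ; (there j) ¬P → there (keep j ¬P) }) ,
  trans (+-suc (suc k) _) (cong suc len)

≤-foldr₁-⊓ : ∀ {X m} (f : A → ℕ) (ys : Vec A (suc m)) → VAll.All (λ y → X ≤ f y) ys →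
  X ≤ Vec.foldr₁ _⊓_ (Vec.map f ys)
≤-foldr₁-⊓ f (y ∷ [])     (p ∷ [])     = p
≤-foldr₁-⊓ f (y ∷ z ∷ ys) (p ∷ ps) = ⊓-glb p (≤-foldr₁-⊓ f (z ∷ ys) ps)

-- Client's components and the edges between two vertex sets.

Connected-weaken : ∀ {n e} {G : Graph n} {u v} → Connected G u v → Connected (e ∷ G) u v
Connected-weaken = Star.map (Sym.map there)

-- `R` will be the reserve: a tip later drawn from it is then certain to be new to `vertices`.
record Reaches {n} (G : Graph n) (s : ℕ) (a : Fin n) (R : List (Fin n)) : Set where
  constructor reaches
  field
    vertices  : List (Fin n)
    unique    : Unique vertices
    size      : length vertices ≡ s
    connected : ∀ {v} → v ∈ vertices → Connected G a v
    avoids    : Disjoint vertices R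

Reaches-mono : ∀ {n} {G : Graph n} {e s a R R′} → R′ ⊆ R → Reaches G s a R → Reaches (e ∷ G) s a R′
Reaches-mono R′⊆R (reaches W u l c d) =
  reaches W u l (λ i → Connected-weaken (c i)) λ (i , j) → d (i , R′⊆R j)

Reaches⇒≤largestComponent : ∀ {n} {G : Graph n} {s a R} → Reaches G s a R → s ≤ largestComponent G
Reaches⇒≤largestComponent {n} {G} {s} {a} (reaches W u refl c _) = v≤max⁺ 0 _ (inj₂ (lose
  (∈-map⁺ (componentOrder G) (∈-allFin a))
  (unique-length-≤ _≡_ _ u (λ {v} i → v , ∈-filter⁺ (connected? G a) (∈-allFin v) (c i) , refl)
    λ { _ _ refl refl → refl })))

-- Edges are stored in one orientation only; this forgets which.
Available : ∀ {n} → List (Edge n) → Fin n → Fin n → Set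
Available free u v = (u , v) ∈ free ⊎ (v , u) ∈ free

Crosses : ∀ {n} → List (Fin n) → List (Fin n) → Edge n → Set
Crosses A R (u , v) = (u ∈ A × v ∈ R) ⊎ (v ∈ A × u ∈ R)

module _ {n : ℕ} where
  open DecMembership (Fin._≟_ {n}) using (_∈?_)

  crosses? : ∀ A R → Decidable (Crosses {n} A R)
  crosses? A R (u , v) = (u ∈? A ×-dec v ∈? R) ⊎-dec (v ∈? A ×-dec u ∈? R)

-- Each pair in `A` times `R` has a stored edge. By disjointness that edge determines the pair,
-- since it cannot be read both ways.
crossing-count : ∀ {n} {A R : List (Fin n)} {free} → Unique A → Unique R → Disjoint A R →
  (∀ {a r} → a ∈ A → r ∈ R → Available free a r) →
  length A * length R ≤ length (filter (crosses? A R) free)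
crossing-count {n} {A} {R} {free} uA uR disj avail =
  subst (_≤ length (filter (crosses? A R) free)) (length-cartesianProduct A R)
    (unique-length-≤ T _ (Unique.cartesianProduct⁺ uA uR) tot inj)
  where
  T : Edge n → Edge n → Set
  T (a , r) e = e ≡ (a , r) ⊎ e ≡ (r , a)
  tot : ∀ {x} → x ∈ cartesianProduct A R → ∃[ e ] e ∈ filter (crosses? A R) free × T x e
  tot {a , r} i with ∈-cartesianProduct⁻ A R i
  ... | a∈ , r∈ with avail a∈ r∈
  ... | inj₁ j = _ , ∈-filter⁺ (crosses? A R) j (inj₁ (a∈ , r∈)) , inj₁ refl
  ... | inj₂ j = _ , ∈-filter⁺ (crosses? A R) j (inj₂ (a∈ , r∈)) , inj₂ refl
  inj : ∀ {x x′ e} → x ∈ cartesianProduct A R → x′ ∈ cartesianProduct A R → T x e → T x′ e → x ≡ x′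
  inj i j (inj₁ refl) (inj₁ refl) = refl
  inj i j (inj₂ refl) (inj₂ refl) = refl
  inj i j (inj₁ refl) (inj₂ refl) =
    contradiction (proj₁ (∈-cartesianProduct⁻ A R i) , proj₂ (∈-cartesianProduct⁻ A R j)) disj
  inj i j (inj₂ refl) (inj₁ refl) =
    contradiction (proj₁ (∈-cartesianProduct⁻ A R j) , proj₂ (∈-cartesianProduct⁻ A R i)) disj

-- Waiter's strategy for a component of order `X`.

module Game {n : ℕ} (q X : ℕ) where

  -- The number of rounds is computed from `free`, so a position needs no separate counter.
  Wins : List (Edge n) → Graph n → Set
  Wins free G = X ≤ value q (length free / suc q) free G

  -- One round: the maximum over offers is at least the value of the chosen offer, and `next` bounds
  -- the minimum by answering every choice `e` of Client.
  offer : ∀ {free G} {P : Edge n → Set} (P? : Decidable P) → suc q ≤ length (filter P? free) →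
    (∀ {e rest} → P e → (∀ {f} → f ∈ free → ¬ P f → f ∈ rest) →
      suc q + length rest ≡ length free → Wins rest (e ∷ G)) →
    Wins free G
  offer {free} {G} P? enough next with choose-satisfying P? (suc q) free enough
  ... | ys , zs , i , Pys , keep , len = subst (λ r → X ≤ value q r free G) (sym rounds)
    (v≤max⁺ 0 _ (inj₂ (lose (∈-map⁺ _ i)
      (≤-foldr₁-⊓ (λ e → value q (length zs / suc q) zs (e ∷ G)) ys (VAll.map (λ Pe → next Pe keep len) Pys)))))
    where
    -- Removing exactly `q + 1` edges lowers the quotient by exactly one.
    rounds : length free / suc q ≡ suc (length zs / suc q)
    rounds = trans (m/n≡1+[m∸n]/n (subst (suc q ≤_) len (m≤m+n (suc q) (length zs))))
      (cong (λ m → suc (m / suc q)) (trans (cong (_∸ suc q) (sym len)) (m+n∸m≡n (suc q) (length zs))))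

  -- The value is read off at the end of the game, so the remaining rounds must still be played. Any
  -- offers will do, because a component never shrinks; `k` is fuel bounding the number of free
  -- edges.
  reached⇒wins : ∀ {a R} free G → Reaches G X a R → Wins free G
  reached⇒wins free G = go (suc (length free)) free G ≤-refl
    where
    go : ∀ {a R} k free G → length free < k → Reaches G X a R → Wins free G
    go (suc k) free G l reach with suc q ≤? length free
    ... | no few = subst (λ r → X ≤ value q r free G) (sym (m<n⇒m/n≡0 (≰⇒> few))) (Reaches⇒≤largestComponent reach)
    ... | yes enough = offer {free} {G} {P = λ _ → ⊤} (λ _ → yes tt)
      (subst (suc q ≤_) (cong length (sym (filter-all (λ _ → yes tt) (All.universal (λ _ → tt) free)))) enough)
      λ {e} {rest} _ _ len → go k rest _
        (<-≤-trans (subst (length rest <_) len (m<n+m (length rest) z<s)) (s≤s⁻¹ l))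
        (Reaches-mono id reach)

  -- The vertex lists of different tips may overlap, since several tips may be attached to the same
  -- earlier one; each list only has to avoid `R`.
  record Ready (s : ℕ) (A R : List (Fin n)) (free : List (Edge n)) (G : Graph n) : Set where
    constructor ready
    field
      unique    : Unique (A ++ R)
      available : ∀ {u v} → u ∈ A ++ R → v ∈ A ++ R → u ≢ v → Available free u v
      reach     : ∀ {a} → a ∈ A → Reaches G s a R

  -- Bookkeeping of one round: `r` leaves its block for the tips `B`, and the rest `S₁ ++ S₂` of the
  -- block joins `D`.
  claim-tip : ∀ (B S₁ S₂ S′ D : List (Fin n)) r →
    B ++ ((S₁ ++ r ∷ S₂) ++ S′) ++ D ↭ (r ∷ B) ++ S′ ++ (S₁ ++ S₂) ++ D
  claim-tip B S₁ S₂ S′ D r = begin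
    B ++ ((S₁ ++ r ∷ S₂) ++ S′) ++ D    ↭⟨ Perm.++⁺ˡ B (Perm.++⁺ʳ D (Perm.++-comm (S₁ ++ r ∷ S₂) S′)) ⟩
    B ++ (S′ ++ S₁ ++ r ∷ S₂) ++ D      ≡⟨ cong (B ++_) (++-assoc S′ _ D) ⟩
    B ++ S′ ++ (S₁ ++ r ∷ S₂) ++ D      ↭⟨ Perm.++⁺ˡ B (Perm.++⁺ˡ S′ (Perm.++⁺ʳ D (Perm.shift r S₁ S₂))) ⟩
    B ++ S′ ++ r ∷ (S₁ ++ S₂) ++ D      ↭⟨ Perm.++⁺ˡ B (Perm.shift r S′ _) ⟩
    B ++ r ∷ S′ ++ (S₁ ++ S₂) ++ D      ↭⟨ Perm.shift r B _ ⟩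
    (r ∷ B) ++ S′ ++ (S₁ ++ S₂) ++ D    ∎
    where open PermutationReasoning

  -- S is the part of the reserve not yet offered, D the vertices passed over in the
  -- blocks already offered, B the new tips, and t the number of rounds to come.
  stage : ∀ {s b A} t B S D {free G} →
    suc q ≤ length A * b → t * b ≤ length S → Unique A → Disjoint A (B ++ S ++ D) →
    (∀ {a v} → a ∈ A → v ∈ S → Available free a v) →
    (∀ {a} → a ∈ A → Reaches G s a (S ++ D)) →
    Ready (suc s) B (S ++ D) free G →
    (∀ {B′ R′ free′ G′} → length B′ ≡ t + length B → length B′ + length R′ ≡ length B + length (S ++ D) →
      Ready (suc s) B′ R′ free′ G′ → Wins free′ G′) →
    Wins free G
  stage zero B S D _ _ _ _ _ _ rdy next = next refl refl rdy
  stage {s} {b} {A} (suc t) B S D {free} {G} b-large S-long uA disj cross reachA (ready uBSD avail reachB) next =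
    offer (crosses? A block) many play
    where
    block = take b S
    S′    = drop b S

    block⊆ : block ⊆ S
    block⊆ i = subst (_ ∈_) (take++drop≡id b S) (∈-++⁺ˡ i)

    S′⊆ : S′ ⊆ S
    S′⊆ i = subst (_ ∈_) (take++drop≡id b S) (∈-++⁺ʳ block i)

    uSD : Unique (S ++ D)
    uSD = proj₁ (proj₂ (Unique-++⁻ B uBSD))

    uS : Unique S
    uS = proj₁ (Unique-++⁻ S uSD)

    block-S′ : Disjoint block S′
    block-S′ = proj₂ (proj₂ (Unique-++⁻ block (subst Unique (sym (take++drop≡id b S)) uS)))

    A-block : Disjoint A block
    A-block (i , j) = disj (i , ∈-++⁺ʳ B (∈-++⁺ˡ (block⊆ j)))

    length-block : length block ≡ b
    length-block = trans (length-take b S) (m≤n⇒m⊓n≡m (≤-trans (m≤m+n b (t * b)) S-long))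

    many : suc q ≤ length (filter (crosses? A block) free)
    many = ≤-trans b-large (subst (λ l → length A * l ≤ length (filter (crosses? A block) free)) length-block
      (crossing-count uA (Unique.take⁺ b uS) A-block λ i j → cross i (block⊆ j)))

    play : ∀ {e rest} → Crosses A block e → (∀ {f} → f ∈ free → ¬ Crosses A block f → f ∈ rest) →
      suc q + length rest ≡ length free → Wins rest (e ∷ G)
    play {e} {rest} e-cross keep _ with pick e-cross
      where
      pick : ∀ {e} → Crosses A block e → ∃₂ λ a r → a ∈ A × r ∈ block × Connected (e ∷ G) r a
      pick (inj₁ (a∈ , r∈)) = _ , _ , a∈ , r∈ , bwd (here refl) ◅ ε
      pick (inj₂ (a∈ , r∈)) = _ , _ , a∈ , r∈ , fwd (here refl) ◅ ε
    ... | a , r , a∈ , r∈ , r~a with ∈-∃++ r∈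
    ... | S₁ , S₂ , block≡ =
      -- The rest of the block goes to `D` because its edges to `A` may be gone, while its edges to
      -- the new tips and within the reserve are intact.
      stage t (r ∷ B) S′ ((S₁ ++ S₂) ++ D) b-large S′-long uA
        (λ (i , j) → disj (i , Perm.∈-resp-↭ (↭-sym perm) j))
        cross′
        (λ i → Reaches-mono rest⊆ (reachA i))
        (ready (Unique-resp-↭ (setoid _) perm′ uBSD)
          (λ i j u≢v → available′ (Perm.∈-resp-↭ (↭-sym perm) i) (Perm.∈-resp-↭ (↭-sym perm) j) u≢v)
          reachB′)
        λ len len′ → next (trans len (+-suc t (length B))) (trans len′ length-kept)
      where
      perm : B ++ S ++ D ↭ (r ∷ B) ++ S′ ++ (S₁ ++ S₂) ++ D
      perm = subst (λ S → B ++ S ++ D ↭ (r ∷ B) ++ S′ ++ (S₁ ++ S₂) ++ D)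
        (trans (cong (_++ S′) (sym block≡)) (take++drop≡id b S)) (claim-tip B S₁ S₂ S′ D r)
      perm′ = ↭⇒↭ₛ perm

      permR : S ++ D ↭ r ∷ S′ ++ (S₁ ++ S₂) ++ D
      permR = subst (λ S → S ++ D ↭ r ∷ S′ ++ (S₁ ++ S₂) ++ D)
        (trans (cong (_++ S′) (sym block≡)) (take++drop≡id b S)) (claim-tip [] S₁ S₂ S′ D r)

      rest⊆ : S′ ++ (S₁ ++ S₂) ++ D ⊆ S ++ D
      rest⊆ i = Perm.∈-resp-↭ (↭-sym permR) (there i)

      r∉rest : r ∉ S′ ++ (S₁ ++ S₂) ++ D
      r∉rest = Unique.Unique[x∷xs]⇒x∉xs (Unique-resp-↭ (setoid _) (↭⇒↭ₛ permR) uSD)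

      S′-long : t * b ≤ length S′
      S′-long = subst (t * b ≤_) (sym (length-drop b S))
        (subst (_≤ length S ∸ b) (m+n∸m≡n b (t * b)) (∸-monoˡ-≤ b S-long))

      length-kept : suc (length B) + length (S′ ++ (S₁ ++ S₂) ++ D) ≡ length B + length (S ++ D)
      length-kept = trans (sym (+-suc (length B) _)) (cong (_+_ (length B)) (sym (Perm.↭-length permR)))

      keep-available : ∀ {u v} → ¬ (Crosses A block (u , v)) → Available free u v → Available rest u v
      keep-available ¬c = Sum.map (λ i → keep i ¬c)
        (λ i → keep i λ { (inj₁ c) → ¬c (inj₂ c) ; (inj₂ c) → ¬c (inj₁ c) })

      -- Later blocks are disjoint from the current one, so their edges to `A` are not offered.
      cross′ : ∀ {a v} → a ∈ A → v ∈ S′ → Available rest a v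
      cross′ a∈ v∈ = keep-available
        (λ { (inj₁ (_ , v∈block)) → block-S′ (v∈block , v∈) ; (inj₂ (_ , a∈block)) → A-block (a∈ , a∈block) })
        (cross a∈ (S′⊆ v∈))

      -- Every crossing edge has an end in `A`, which is disjoint from `B ++ S ++ D`.
      available′ : ∀ {u v} → u ∈ B ++ S ++ D → v ∈ B ++ S ++ D → u ≢ v → Available rest u v
      available′ i j u≢v = keep-available
        (λ { (inj₁ (c , _)) → disj (c , i) ; (inj₂ (c , _)) → disj (c , j) })
        (avail i j u≢v)

      reachB′ : ∀ {w} → w ∈ r ∷ B → Reaches (e ∷ G) (suc s) w (S′ ++ (S₁ ++ S₂) ++ D)
      reachB′ (there i) = Reaches-mono rest⊆ (reachB i)
      reachB′ (here refl) with reachA a∈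
      -- `r` comes from the reserve, which `W` avoids, and is linked to `W` through `a`.
      ... | reaches W u l c d = reaches (r ∷ W)
        (All.tabulate (λ { i refl → d (i , ∈-++⁺ˡ (block⊆ r∈)) }) ∷ u)
        (cong suc l)
        (λ { (here refl) → ε ; (there i) → r~a ◅◅ Connected-weaken (c i) })
        (λ { (here refl , j) → r∉rest j ; (there i , j) → d (i , rest⊆ j) })

  -- The summands q + K^k make room for K^(k-1) blocks of size b, where b is least with
  -- K^k b > q. The summand K · K^k pays for the tips leaving the reserve in all stages.
  levels : ∀ {K} → 2 ≤ K → ∀ k {s A R free G} → Ready s A R free G → length A ≡ K ^ k →
    q + K ^ k + K * K ^ k ≤ K * length R → X ≡ s + k → Wins free G
  -- There are `K ^ 0`, that is one, tips left, and this one already reaches `X` vertices.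
  levels K≥2 zero {s} {A = a ∷ _} {free = free} {G} rdy _ _ X≡ =
    reached⇒wins free G (subst (λ X → Reaches G X a _) (sym (trans X≡ (+-identityʳ s))) (Ready.reach rdy (here refl)))
  levels {K} K≥2 (suc k) {s} {A} {R} {free} {G} (ready u avail reach) lenA big X≡ =
    stage {s = s} {b} {A} (K ^ k) [] R [] b-large t-small uA
      (λ (i , j) → disj (i , subst (_ ∈_) (List.++-identityʳ R) j))
      (λ i j → avail (∈-++⁺ˡ i) (∈-++⁺ʳ A j) λ { refl → disj (i , j) })
      (λ i → subst (Reaches G s _) (sym R≡) (reach i))
      (subst (λ R → Ready (suc s) [] R free G) (sym R≡) (ready uR (λ i j → avail (∈-++⁺ʳ A i) (∈-++⁺ʳ A j)) λ ()))
      next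
    where
    open ≤-Reasoning
    R≡ = List.++-identityʳ R
    instance
      K≢0 : NonZero K
      K≢0 = >-nonZero (≤-trans (s≤s z≤n) K≥2)
      K^≢0 : NonZero (K ^ suc k)
      K^≢0 = m^n≢0 K (suc k)
    b = suc (q / K ^ suc k)
    split = Unique-++⁻ A u
    uA = proj₁ split
    uR = proj₁ (proj₂ split)
    disj = proj₂ (proj₂ split)

    b-large : suc q ≤ length A * b
    b-large = begin
      suc q          ≡⟨ cong suc (m≡m%n+[m/n]*n q (K ^ suc k)) ⟩
      suc (q % K ^ suc k) + q / K ^ suc k * K ^ suc k ≤⟨ +-monoˡ-≤ _ (m%n<n q (K ^ suc k)) ⟩
      b * K ^ suc k  ≡⟨ *-comm b (K ^ suc k) ⟩
      K ^ suc k * b  ≡⟨ cong (_* b) lenA ⟨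
      length A * b   ∎

    t-small : K ^ k * b ≤ length R
    t-small = *-cancelˡ-≤ K (begin
      K * (K ^ k * b)                           ≡⟨ *-assoc K (K ^ k) b ⟨
      K ^ suc k * b                             ≡⟨ *-comm (K ^ suc k) b ⟩
      K ^ suc k + q / K ^ suc k * K ^ suc k     ≤⟨ +-monoʳ-≤ (K ^ suc k) (m/n*n≤m q (K ^ suc k)) ⟩
      K ^ suc k + q                             ≡⟨ +-comm (K ^ suc k) q ⟩
      q + K ^ suc k                             ≤⟨ m≤m+n _ _ ⟩
      q + K ^ suc k + K * K ^ suc k             ≤⟨ big ⟩
      K * length R                              ∎)

    next : ∀ {B′ R′ free′ G′} → length B′ ≡ K ^ k + 0 → length B′ + length R′ ≡ length (R ++ []) →
      Ready (suc s) B′ R′ free′ G′ → Wins free′ G′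
    -- The `K ^ k` new tips left the reserve, which costs `K ^ suc k` on the right. As `2 ≤ K`, the
    -- summand `K * K ^ suc k` covers this cost and the summand `K * K ^ k` of the next stage.
    next {B′} {R′} lenB lenR rdy = levels K≥2 k rdy lenB′
      (+-cancelˡ-≤ (K ^ suc k) _ _ (begin
        K ^ suc k + (q + K ^ k + K ^ suc k)  ≡⟨ +-comm (K ^ suc k) _ ⟩
        q + K ^ k + K ^ suc k + K ^ suc k    ≤⟨ +-monoˡ-≤ _ (+-monoˡ-≤ _ (+-monoʳ-≤ q (m≤n*m (K ^ k) K))) ⟩
        q + K ^ suc k + K ^ suc k + K ^ suc k ≡⟨ +-assoc (q + K ^ suc k) _ _ ⟩
        q + K ^ suc k + (K ^ suc k + K ^ suc k) ≡⟨ cong (λ z → q + K ^ suc k + (K ^ suc k + z)) (+-identityʳ _) ⟨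
        q + K ^ suc k + 2 * K ^ suc k        ≤⟨ +-monoʳ-≤ (q + K ^ suc k) (*-monoˡ-≤ (K ^ suc k) K≥2) ⟩
        q + K ^ suc k + K * K ^ suc k        ≤⟨ big ⟩
        K * length R                         ≡⟨ cong (λ R → K * length R) R≡ ⟨
        K * length (R ++ [])                 ≡⟨ cong (K *_) lenR ⟨
        K * (length B′ + length R′)          ≡⟨ cong (λ l → K * (l + length R′)) lenB′ ⟩
        K * (K ^ k + length R′)              ≡⟨ *-distribˡ-+ K (K ^ k) (length R′) ⟩
        K ^ suc k + K * length R′            ∎))
      (trans X≡ (+-suc s k))
      where
      lenB′ : length B′ ≡ K ^ k
      lenB′ = trans lenB (+-identityʳ _)

-- The opening position and the number of stages.

edgesK-available : ∀ {n} {u v : Fin n} → u ≢ v → Available (edgesK n) u v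
edgesK-available {n} {u} {v} u≢v with Fin.<-cmp u v
... | tri< u<v _ _ = inj₁ (∈-filter⁺ (λ (u , v) → u Fin.<? v) (∈-cartesianProduct⁺ (∈-allFin u) (∈-allFin v)) u<v)
... | tri≈ _ u≡v _ = contradiction u≡v u≢v
... | tri> _ _ v<u = inj₂ (∈-filter⁺ (λ (u , v) → u Fin.<? v) (∈-cartesianProduct⁺ (∈-allFin v) (∈-allFin u)) v<u)

𝓛-lower-bound : ∀ {K n q} → 2 ≤ K → ∀ k → K ^ k ≤ n → q + K ^ k + K * K ^ k ≤ K * (n ∸ K ^ k) → suc k ≤ 𝓛 n q
𝓛-lower-bound {K} {n} {q} K≥2 k K^k≤n big =
  -- Initially a tip reaches only itself, so `k` stages end with `1 + k` vertices.
  levels K≥2 k {1} {tips} {reserve} {edgesK n} {[]}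
    (ready unique (λ _ _ → edgesK-available) λ {a} a∈ → reaches [ a ] ([] ∷ []) refl (λ { (here refl) → ε })
      λ { (here refl , r∈) → proj₂ (proj₂ (Unique-++⁻ tips unique)) (a∈ , r∈) })
    (trans (length-take (K ^ k) V) (m≤n⇒m⊓n≡m (subst (K ^ k ≤_) (sym lenV) K^k≤n)))
    (subst (λ l → q + K ^ k + K * K ^ k ≤ K * l) (sym (trans (length-drop (K ^ k) V) (cong (_∸ K ^ k) lenV)))
      big)
    refl
  where
  open Game {n} q (suc k)
  V = allFin n
  tips = take (K ^ k) V
  reserve = drop (K ^ k) V
  lenV : length V ≡ n
  lenV = length-tabulate id
  unique : Unique (tips ++ reserve)
  unique = subst Unique (sym (take++drop≡id (K ^ k) V)) (Unique.allFin⁺ n)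

-- With `K = 2 + C`, the product `K * n` splits into `C * n`, `n` and `n`. These pay for `q`, for
-- `K ^ k`, and for two copies of `K ^ suc k`: one from the hypothesis of `𝓛-lower-bound`, one for
-- the initial tips. The exponent `2 + k` fits both copies into the last `n`, since `2 ≤ K`.
𝓛-logarithmic : ∀ {C n q} k → q ≤ C * n → (2 + C) ^ (2 + k) ≤ n → suc k ≤ 𝓛 n q
𝓛-logarithmic {C} {n} {q} k q≤ K^≤n = 𝓛-lower-bound (m≤m+n 2 C) k K^k≤n (begin
  q + K ^ k + K * K ^ k            ≤⟨ m+n≤o⇒m≤o∸n (q + K ^ k + K * K ^ k) (begin
    q + K ^ k + K * K ^ k + K * K ^ k   ≡⟨ +-assoc (q + K ^ k) _ _ ⟩
    q + K ^ k + (K ^ suc k + K ^ suc k) ≡⟨ cong (λ z → q + K ^ k + (K ^ suc k + z)) (+-identityʳ _) ⟨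
    q + K ^ k + 2 * K ^ suc k           ≤⟨ +-mono-≤ (+-mono-≤ q≤ K^k≤n) (*-monoˡ-≤ (K ^ suc k) (m≤m+n 2 C)) ⟩
    C * n + n + K ^ (2 + k)             ≤⟨ +-monoʳ-≤ (C * n + n) K^≤n ⟩
    C * n + n + n                       ≡⟨ +-comm (C * n + n) n ⟩
    n + (C * n + n)                     ≡⟨ cong (_+_ n) (+-comm (C * n) n) ⟩
    K * n                               ∎) ⟩
  K * n ∸ K * K ^ k                ≡⟨ *-distribˡ-∸ K n (K ^ k) ⟨
  K * (n ∸ K ^ k)                  ∎)
  where
  open ≤-Reasoning
  K = 2 + C
  K^k≤n : K ^ k ≤ n
  K^k≤n = ≤-trans (^-monoʳ-≤ K (m≤n+m k 2)) K^≤n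

power-bracket : ∀ {K} → 2 ≤ K → ∀ n → ∃[ j ] K ^ j ≤ suc n × suc n < K ^ suc j
power-bracket {K} K≥2 zero = 0 , ≤-refl , subst (1 <_) (sym (*-identityʳ K)) K≥2
power-bracket {K} K≥2 (suc n) with power-bracket K≥2 n
... | j , lo , hi with 2 + n <? K ^ suc j
...   | yes p = j , m≤n⇒m≤1+n lo , p
-- One increment suffices: `2 + n` is still at most `K ^ suc j`.
...   | no ¬p = suc j , ≮⇒≥ ¬p , ≤-<-trans hi (^-monoʳ-< K K≥2 (n<1+n (suc j)))

-- Rational arithmetic, carried out by cross-multiplication on unnormalised fractions.

/-mono-≤ : ∀ p q r s → p * suc s ≤ r * suc q → + p ℚ./ suc q ℚ.≤ + r ℚ./ suc s
/-mono-≤ p q r s le = ℚ.toℚᵘ-cancel-≤ (begin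
  ℚ.toℚᵘ (ℚ.fromℚᵘ (mkℚᵘ (+ p) q)) ≃⟨ ℚ.toℚᵘ-fromℚᵘ _ ⟩
  mkℚᵘ (+ p) q                     ≤⟨ ℚᵘ.*≤* (subst₂ ℤ._≤_ (ℤ.pos-* p (suc s)) (ℤ.pos-* r (suc q)) (+≤+ le)) ⟩
  mkℚᵘ (+ r) s                     ≃⟨ ℚ.toℚᵘ-fromℚᵘ _ ⟨
  ℚ.toℚᵘ (ℚ.fromℚᵘ (mkℚᵘ (+ r) s)) ∎)
  where open ℚᵘ.≤-Reasoning

fromℕ-mono-≤ : ∀ {m n} → m ≤ n → fromℕ m ℚ.≤ fromℕ n
fromℕ-mono-≤ {m} {n} = /-mono-≤ m 0 n 0 ∘ *-monoˡ-≤ 1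

fromℕ-cancel-≤ : ∀ {m n} → fromℕ m ℚ.≤ fromℕ n → m ≤ n
fromℕ-cancel-≤ {m} {n} le = *-cancelʳ-≤ m n 1 (ℤ.drop‿+≤+
  (subst₂ ℤ._≤_ (sym (ℤ.pos-* m 1)) (sym (ℤ.pos-* n 1)) (ℚᵘ.drop-*≤* (begin
    mkℚᵘ (+ m) 0      ≃⟨ ℚ.toℚᵘ-fromℚᵘ _ ⟨
    ℚ.toℚᵘ (fromℕ m)  ≤⟨ ℚ.toℚᵘ-mono-≤ le ⟩
    ℚ.toℚᵘ (fromℕ n)  ≃⟨ ℚ.toℚᵘ-fromℚᵘ _ ⟩
    mkℚᵘ (+ n) 0      ∎))))
  where open ℚᵘ.≤-Reasoning

/-* : ∀ p q r s m n → p * r * suc n ≡ m * (suc q * suc s) → (+ p ℚ./ suc q) ℚ.* (+ r ℚ./ suc s) ≡ + m ℚ./ suc n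
/-* p q r s m n eq = ℚ.toℚᵘ-injective (begin
  ℚ.toℚᵘ ((+ p ℚ./ suc q) ℚ.* (+ r ℚ./ suc s))
    ≈⟨ ℚ.toℚᵘ-homo-* (+ p ℚ./ suc q) (+ r ℚ./ suc s) ⟩
  ℚ.toℚᵘ (+ p ℚ./ suc q) ℚᵘ.* ℚ.toℚᵘ (+ r ℚ./ suc s)
    ≈⟨ ℚᵘ.*-cong (ℚ.toℚᵘ-fromℚᵘ (mkℚᵘ (+ p) q)) (ℚ.toℚᵘ-fromℚᵘ (mkℚᵘ (+ r) s)) ⟩
  mkℚᵘ (+ p) q ℚᵘ.* mkℚᵘ (+ r) s
    ≈⟨ ℚᵘ.*≡* lemma ⟩
  mkℚᵘ (+ m) n
    ≈⟨ ℚ.toℚᵘ-fromℚᵘ _ ⟨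
  ℚ.toℚᵘ (+ m ℚ./ suc n)
    ∎)
  where
  open import Relation.Binary.Reasoning.Setoid ℚᵘ.≃-setoid
  lemma : + p ℤ.* + r ℤ.* + suc n ≡ + m ℤ.* + (suc q * suc s)
  lemma = trans (cong (ℤ._* + suc n) (sym (ℤ.pos-* p r)))
    (trans (sym (ℤ.pos-* (p * r) (suc n))) (trans (cong +_ eq) (ℤ.pos-* m (suc q * suc s))))

fromℕ-* : ∀ m n → fromℕ (m * n) ≡ fromℕ m ℚ.* fromℕ n
fromℕ-* m n = sym (/-* m 0 n 0 (m * n) 0 refl)

fromℕ-suc : ∀ n → fromℕ (suc n) ≡ 1ℚ ℚ.+ fromℕ n
fromℕ-suc n = ℚ.toℚᵘ-injective (begin
  ℚ.toℚᵘ (fromℕ (suc n))           ≈⟨ ℚ.toℚᵘ-fromℚᵘ _ ⟩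
  mkℚᵘ (+ suc n) 0                 ≈⟨ ℚᵘ.*≡* (cong (λ z → + suc z ℤ.* + 1) (sym (*-identityʳ n))) ⟩
  mkℚᵘ (+ suc (n * 1)) 0           ≈⟨ ℚᵘ.*≡* (cong (λ z → (+ 1 ℤ.+ z) ℤ.* + 1) (ℤ.pos-* n 1)) ⟩
  ℚ.toℚᵘ 1ℚ ℚᵘ.+ mkℚᵘ (+ n) 0      ≈⟨ ℚᵘ.+-congʳ (ℚ.toℚᵘ 1ℚ) (ℚ.toℚᵘ-fromℚᵘ (mkℚᵘ (+ n) 0)) ⟨
  ℚ.toℚᵘ 1ℚ ℚᵘ.+ ℚ.toℚᵘ (fromℕ n)  ≈⟨ ℚ.toℚᵘ-homo-+ 1ℚ (fromℕ n) ⟨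
  ℚ.toℚᵘ (1ℚ ℚ.+ fromℕ n)          ∎)
  where open import Relation.Binary.Reasoning.Setoid ℚᵘ.≃-setoid

fromℕ-+ : ∀ m n → fromℕ (m + n) ≡ fromℕ m ℚ.+ fromℕ n
fromℕ-+ zero    n = sym (ℚ.+-identityˡ (fromℕ n))
fromℕ-+ (suc m) n = trans (fromℕ-suc (m + n)) (trans (cong (1ℚ ℚ.+_) (fromℕ-+ m n))
  (trans (sym (ℚ.+-assoc 1ℚ (fromℕ m) (fromℕ n))) (cong (ℚ._+ fromℕ n) (sym (fromℕ-suc m)))))

-- Upper bounds for the lower sums of the logarithm.

-- A segment of the harmonic series, from `1/(a+1)` to `1/(a+b)`. The free starting point allows it
-- to be cut into pieces.
reciprocalSum : ℕ → ℕ → ℚ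
reciprocalSum a zero    = 0ℚ
reciprocalSum a (suc b) = + 1 ℚ./ suc a ℚ.+ reciprocalSum (suc a) b

reciprocalSum-applyUpTo : ∀ a b (f : ℕ → ℚ) → (∀ i → f i ≡ + 1 ℚ./ suc (a + i)) →
  foldr ℚ._+_ 0ℚ (applyUpTo f b) ≡ reciprocalSum a b
reciprocalSum-applyUpTo a zero    f eq = refl
reciprocalSum-applyUpTo a (suc b) f eq = cong₂ ℚ._+_
  (trans (eq 0) (cong (λ z → + 1 ℚ./ suc z) (+-identityʳ a)))
  (reciprocalSum-applyUpTo (suc a) b (f ∘ suc) λ i → trans (eq (suc i)) (cong (λ z → + 1 ℚ./ suc z) (+-suc a i)))

lnLowerSum≡reciprocalSum : ∀ n m → lnLowerSum n m ≡ reciprocalSum m ((n ∸ 1) * m)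
lnLowerSum≡reciprocalSum n m = trans (cong (foldr ℚ._+_ 0ℚ) (map-upTo _ ((n ∸ 1) * m)))
  (reciprocalSum-applyUpTo m ((n ∸ 1) * m) _ λ _ → refl)

reciprocalSum-+ : ∀ a b b′ → reciprocalSum a (b + b′) ≡ reciprocalSum a b ℚ.+ reciprocalSum (a + b) b′
reciprocalSum-+ a zero    b′ = trans (cong (λ z → reciprocalSum z b′) (sym (+-identityʳ a))) (sym (ℚ.+-identityˡ _))
reciprocalSum-+ a (suc b) b′ = trans
  (cong (+ 1 ℚ./ suc a ℚ.+_) (trans (reciprocalSum-+ (suc a) b b′)
    (cong (λ z → reciprocalSum (suc a) b ℚ.+ reciprocalSum z b′) (sym (+-suc a b)))))
  (sym (ℚ.+-assoc (+ 1 ℚ./ suc a) _ _))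

-- `a₀` stays fixed while `a` advances, so that all terms are compared with the same first
-- reciprocal.
reciprocalSum-≤-* : ∀ {a a₀} b → a₀ ≤ a → reciprocalSum a b ℚ.≤ fromℕ b ℚ.* (+ 1 ℚ./ suc a₀)
reciprocalSum-≤-* {a} {a₀} zero    _   = ℚ.≤-reflexive (sym (ℚ.*-zeroˡ (+ 1 ℚ./ suc a₀)))
reciprocalSum-≤-* {a} {a₀} (suc b) a₀≤ = begin
  + 1 ℚ./ suc a ℚ.+ reciprocalSum (suc a) b
    ≤⟨ ℚ.+-mono-≤ (/-mono-≤ 1 a 1 a₀ (*-monoʳ-≤ 1 (s≤s a₀≤))) (reciprocalSum-≤-* b (m≤n⇒m≤1+n a₀≤)) ⟩
  r ℚ.+ fromℕ b ℚ.* r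
    ≡⟨ cong (ℚ._+ fromℕ b ℚ.* r) (ℚ.*-identityˡ r) ⟨
  1ℚ ℚ.* r ℚ.+ fromℕ b ℚ.* r
    ≡⟨ ℚ.*-distribʳ-+ r 1ℚ (fromℕ b) ⟨
  (1ℚ ℚ.+ fromℕ b) ℚ.* r
    ≡⟨ cong (ℚ._* r) (fromℕ-suc b) ⟨
  fromℕ (suc b) ℚ.* r
    ∎
  where
  open ℚ.≤-Reasoning
  r = + 1 ℚ./ suc a₀

reciprocalSum-≤ : ∀ {a} b d → b ≤ d * a → reciprocalSum a b ℚ.≤ fromℕ d
reciprocalSum-≤ {a} b d b≤ = ℚ.≤-trans (reciprocalSum-≤-* b (≤-refl {a})) (begin
  fromℕ b ℚ.* (+ 1 ℚ./ suc a)
    ≡⟨ /-* b 0 1 a b a (cong₂ _*_ (*-identityʳ b) (sym (+-identityʳ (suc a)))) ⟩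
  + b ℚ./ suc a
    ≤⟨ /-mono-≤ b a d 0 (≤-trans (≤-reflexive (*-identityʳ b)) (≤-trans b≤ (*-monoʳ-≤ d (n≤1+n a)))) ⟩
  fromℕ d
    ∎)
  where open ℚ.≤-Reasoning

-- Geometric cutting: the stretch from `a` to `suc K * a` has `K * a` terms, each below `1/a`, and
-- so contributes at most `K`. At most `J` such stretches cover the sum.
reciprocalSum-^ : ∀ {K} J a b → a + b ≤ a * suc K ^ J → reciprocalSum a b ℚ.≤ fromℕ (J * K)
reciprocalSum-^ {K} zero a b le
  with n≤0⇒n≡0 (+-cancelˡ-≤ a b 0 (≤-trans le (≤-reflexive (trans (*-identityʳ a) (sym (+-identityʳ a))))))
... | refl = ℚ.≤-refl
reciprocalSum-^ {K} (suc J) a b le with ≤-total b (K * a)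
... | inj₁ b≤ = ℚ.≤-trans (reciprocalSum-≤ b K b≤) (fromℕ-mono-≤ (m≤m+n K (J * K)))
... | inj₂ ≤b with m≤n⇒∃[o]m+o≡n ≤b
... | b′ , refl = begin
  reciprocalSum a (K * a + b′)
    ≡⟨ reciprocalSum-+ a (K * a) b′ ⟩
  reciprocalSum a (K * a) ℚ.+ reciprocalSum (suc K * a) b′
    ≤⟨ ℚ.+-mono-≤ (reciprocalSum-≤ (K * a) K ≤-refl) (reciprocalSum-^ J (suc K * a) b′ le′) ⟩
  fromℕ K ℚ.+ fromℕ (J * K)
    ≡⟨ fromℕ-+ K (J * K) ⟨
  fromℕ (suc J * K)
    ∎
  where
  open ℚ.≤-Reasoning
  le′ : suc K * a + b′ ≤ suc K * a * suc K ^ J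
  le′ = ≤-trans (≤-reflexive (+-assoc a (K * a) b′)) (≤-trans le (≤-reflexive
    (trans (sym (*-assoc a (suc K) (suc K ^ J))) (cong (_* suc K ^ J) (*-comm a (suc K))))))

-- Here the segment runs from `m` to `n * m`, a ratio of `n` for every `m`; hence a bound uniform in
-- the partition.
lnLowerSum-≤ : ∀ {K n} J m → 0 < n → n ≤ suc K ^ J → lnLowerSum n m ℚ.≤ fromℕ (J * K)
lnLowerSum-≤ {K} {suc n} J m _ n≤ = subst (ℚ._≤ fromℕ (J * K)) (sym (lnLowerSum≡reciprocalSum (suc n) m))
  (reciprocalSum-^ J m (n * m) (≤-trans (*-monoˡ-≤ m n≤) (≤-reflexive (*-comm (suc K ^ J) m))))

-- Choice of the constants.

-- Denominators are at least 1. This replaces the rational `c` by a natural `C` with `q ≤ C * n`.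
≤-∣numerator∣ : ∀ {c} → 0ℚ ℚ.< c → c ℚ.≤ fromℕ ℤ.∣ ℚ.↥ c ∣
≤-∣numerator∣ {mkℚ (+ p) d co} _ = ℚ.toℚᵘ-cancel-≤ (begin
  mkℚᵘ (+ p) d      ≤⟨ ℚᵘ.*≤* (subst₂ ℤ._≤_ (ℤ.pos-* p 1) (ℤ.pos-* p (suc d)) (+≤+ (*-monoʳ-≤ p (s≤s z≤n)))) ⟩
  mkℚᵘ (+ p) 0      ≃⟨ ℚ.toℚᵘ-fromℚᵘ _ ⟨
  ℚ.toℚᵘ (fromℕ p)  ∎)
  where open ℚᵘ.≤-Reasoning
≤-∣numerator∣ {mkℚ (ℤ.-[1+ p ]) d co} (ℚ.*<* ())

proposition1p2 :
    (c : ℚ) → 0ℚ ℚ.< c →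
    ∃[ c′ ] (0ℚ ℚ.< c′ × ∃[ n₀ ] (
      ∀ (n q : ℕ) → 0 < n → 0 < q → n₀ ≤ n → fromℕ q ≡ c ℚ.* fromℕ n →
      c′ ·ln n ≤ fromℕ (𝓛 n q)))
proposition1p2 c c>0 = c′ , ℚ.positive⁻¹ c′ {{c′>0}} , K ^ 2 , main
  where
  C = ℤ.∣ ℚ.↥ c ∣
  K = 2 + C
  -- For `n` between `K ^ (2 + k)` and `K ^ (3 + k)` the lower sums are at most `(3 + k) * suc C`,
  -- and Waiter gets `suc k`. The factor 3 comes from `3 + k ≤ 3 * suc k`.
  c′ = + 1 ℚ./ (3 * K)
  c′>0 : ℚ.Positive c′
  c′>0 = ℚ.normalize-pos 1 (3 * K)
  c′≥0 : ℚ.NonNegative c′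
  c′≥0 = ℚ.pos⇒nonNeg c′ {{c′>0}}

  bound : ∀ n q k m → 0 < n → q ≤ C * n → K ^ (2 + k) ≤ n → n < K ^ (3 + k) → c′ ℚ.* lnLowerSum n m ℚ.≤ fromℕ (𝓛 n q)
  bound n q k m n>0 q≤ lo hi = begin
    c′ ℚ.* lnLowerSum n m
      ≤⟨ ℚ.*-monoˡ-≤-nonNeg c′ {{c′≥0}} (lnLowerSum-≤ (3 + k) m n>0 (<⇒≤ hi)) ⟩
    c′ ℚ.* fromℕ ((3 + k) * suc C)
      ≤⟨ ℚ.*-monoˡ-≤-nonNeg c′ {{c′≥0}} (fromℕ-mono-≤ 3+k≤) ⟩
    c′ ℚ.* fromℕ (suc k * (3 * K))
      -- Denominators are passed as predecessors; `suc C + 2 * K` is that of `3 * K`.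
      ≡⟨ /-* 1 (suc C + 2 * K) (suc k * (3 * K)) 0 (suc k) 0 cancel ⟩
    fromℕ (suc k)
      ≤⟨ fromℕ-mono-≤ (𝓛-logarithmic k q≤ lo) ⟩
    fromℕ (𝓛 n q)
      ∎
    where
    open ℚ.≤-Reasoning
    cancel : 1 * (suc k * (3 * K)) * 1 ≡ suc k * (3 * K * 1)
    cancel = trans (*-identityʳ (1 * (suc k * (3 * K))))
      (trans (*-identityˡ (suc k * (3 * K))) (cong (suc k *_) (sym (*-identityʳ (3 * K)))))
    3+k≤ : (3 + k) * suc C ≤ suc k * (3 * K)
    3+k≤ = ≤-trans (*-mono-≤ (+-monoʳ-≤ 3 (m≤m*n k 3)) (n≤1+n (suc C))) (≤-reflexive (*-assoc (suc k) 3 K))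

  main : ∀ n q → 0 < n → 0 < q → K ^ 2 ≤ n → fromℕ q ≡ c ℚ.* fromℕ n → c′ ·ln n ≤ fromℕ (𝓛 n q)
  main (suc n) q n>0 _ n₀≤n q≡cn m with power-bracket (m≤m+n 2 C) n
  -- The threshold `K ^ 2` rules out exponents below 2.
  ... | zero        , lo , hi = contradiction (≤-<-trans n₀≤n hi) (≤⇒≯ (^-monoʳ-≤ K {1} {2} (s≤s z≤n)))
  ... | suc zero    , lo , hi = contradiction (≤-<-trans n₀≤n hi) (<-irrefl refl)
  ... | suc (suc k) , lo , hi = bound (suc n) q k m n>0 (fromℕ-cancel-≤ q≤) lo hi
    where
    open ℚ.≤-Reasoning
    q≤ : fromℕ q ℚ.≤ fromℕ (C * suc n)
    q≤ = begin
      fromℕ q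
        ≡⟨ q≡cn ⟩
      c ℚ.* fromℕ (suc n)
        ≤⟨ ℚ.*-monoʳ-≤-nonNeg (fromℕ (suc n)) {{ℚ.normalize-nonNeg (suc n) 1}} (≤-∣numerator∣ c>0) ⟩
      fromℕ C ℚ.* fromℕ (suc n)
        ≡⟨ fromℕ-* C (suc n) ⟨
      fromℕ (C * suc n)
        ∎
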